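{- Let $n \ge 1$ be an integer and let $A \subseteq \mathbb{Z}_n \setminus \{0\}$ with $|A| = k \le 5$. Then there is an ordering $(a_1,\dots,a_k)$ of the elements of $A$ such that the partial sums $s_j = \sum_{i=1}^{j} a_i$ ($1 \le j \le k$, computed in $\mathbb{Z}_n$) are pairwise distinct. -}

module Defs where

open import Data.Nat using (ℕ; suc; _+_; _%_)
open import Data.Nat.DivMod using (m%n<n)
open import Data.Fin using (Fin; zero; toℕ; fromℕ<)
open import Data.List using (List; []; _∷_)

-- The cyclic group ℤ_n with n = suc m (so n ≥ 1), carrier Fin n,
-- addition modulo n.
_+ₙ_ : {m : ℕ} → Fin (suc m) → Fin (suc m) → Fin (suc m)
_+ₙ_ {m} a b = fromℕ< (m%n<n (toℕ a + toℕ b) (suc m))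

partialSumsFrom : {m : ℕ} → Fin (suc m) → List (Fin (suc m)) → List (Fin (suc m))
partialSumsFrom acc []       = []
partialSumsFrom acc (a ∷ as) = (acc +ₙ a) ∷ partialSumsFrom (acc +ₙ a) as

partialSums : {m : ℕ} → List (Fin (suc m)) → List (Fin (suc m))
partialSums = partialSumsFrom zero

{-# OPTIONS --safe #-}

-- Let s be the sum of A.  Two partial sums agree iff the block between them
-- sums to zero, so an ordering is good as soon as no non-empty block avoiding
-- its first entry sums to zero.  Put some a ≠ s first; the remaining at most
-- four elements then have a sum t ≠ 0.  At most one element cancels a given
-- one, so the pairs of sum zero form a matching, and a triple among four
-- remaining elements sums to zero iff the fourth element w equals t.  If there
-- is such a w, place it second, next to elements that do not cancel it: then
-- both triples contain w, and no pair in the complement of w can sum to zero.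
-- Otherwise only the matching has to be avoided.
module Submission where

open import Defs
open import Data.Nat using (ℕ; suc; _≤_; s≤s; _%_; _∸_) renaming (_+_ to _+ℕ_)
open import Data.Nat.DivMod using (m%n<n; m<n⇒m%n≡m; n%n≡0; %-distribˡ-+)
import Data.Nat.Properties as ℕ
open import Data.Fin using (Fin; zero; toℕ; fromℕ<)
open import Data.Fin.Properties using (toℕ-fromℕ<; toℕ-injective; toℕ<n; _≟_)
open import Data.List using (List; []; _∷_; length; foldl; map)
open import Data.List.Properties using (foldl-∷ʳ)
open import Data.List.Membership.Propositional using (_∈_; find)
open import Data.List.Relation.Unary.All using (All; []; _∷_)
import Data.List.Relation.Unary.All as All
open import Data.List.Relation.Unary.All.Properties using (map⁺; ¬Any⇒All¬)
open import Data.List.Relation.Unary.AllPairs using ([]; _∷_)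
open import Data.List.Relation.Unary.Any using (here; there; any?)
open import Data.List.Relation.Unary.Unique.Propositional using (Unique)
open import Data.List.Relation.Binary.Permutation.Propositional
  using (_↭_; refl; prep; swap; trans; ↭-sym; ↭⇒↭ₛ)
open import Data.List.Relation.Binary.Permutation.Propositional.Properties
  using (All-resp-↭; ∈-resp-↭; ++-comm)
import Data.List.Relation.Binary.Permutation.Setoid.Properties as Permₛ
open import Data.Product using (∃; ∃-syntax; _×_; _,_)
open import Data.Unit using (⊤; tt)
open import Data.Vec using (Vec; toList; []; _∷_)
open import Function using (_∘_)
open import Relation.Nullary using (¬_; yes; no)
open import Relation.Binary.PropositionalEquality
  using (_≡_; _≢_; refl; sym; cong; cong₂; subst; setoid; module ≡-Reasoning)
  renaming (trans to ≡-trans)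

-- Permutations of lists

-- Vectors keep track of the length, so that matching on the remainder `w` names exactly the
-- elements left over.
extract : ∀ {A : Set} {n x} (v : Vec A (suc n)) → x ∈ toList v →
          ∃[ w ] (x ∷ toList {n = n} w ↭ toList v)
extract (y ∷ v)     (here refl) = v , refl
extract {x = x} (y ∷ z ∷ v) (there x∈v) with extract (z ∷ v) x∈v
... | w , σ = y ∷ w , trans (swap x y refl) (prep y σ)

Unique-resp-↭ : ∀ {A : Set} {xs ys : List A} → xs ↭ ys → Unique xs → Unique ys
Unique-resp-↭ = Permₛ.Unique-resp-↭ (setoid _) ∘ ↭⇒↭ₛ

module _ {m : ℕ} where

  private
    n = suc m
    ℤₙ = Fin n

  -- Group laws of ℤₙ

  residue : ℕ → ℤₙ
  residue k = fromℕ< (m%n<n k n)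

  residue-toℕ : ∀ a → residue (toℕ a) ≡ a
  residue-toℕ a = toℕ-injective (≡-trans (toℕ-fromℕ< _) (m<n⇒m%n≡m (toℕ<n a)))

  -- Reduction modulo `n` is a homomorphism, which lets associativity and inverses be carried over
  -- from ℕ.
  residue-+ : ∀ j k → residue j +ₙ residue k ≡ residue (j +ℕ k)
  residue-+ j k = toℕ-injective (begin
    toℕ (residue j +ₙ residue k)             ≡⟨ toℕ-fromℕ< _ ⟩
    (toℕ (residue j) +ℕ toℕ (residue k)) % n ≡⟨ cong₂ (λ u v → (u +ℕ v) % n) (toℕ-fromℕ< (m%n<n j n)) (toℕ-fromℕ< (m%n<n k n)) ⟩
    (j % n +ℕ k % n) % n                     ≡⟨ %-distribˡ-+ j k n ⟨
    (j +ℕ k) % n                             ≡⟨ toℕ-fromℕ< _ ⟨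
    toℕ (residue (j +ℕ k))                   ∎)
    where open ≡-Reasoning

  +ₙ-comm : ∀ (a b : ℤₙ) → a +ₙ b ≡ b +ₙ a
  +ₙ-comm a b = cong residue (ℕ.+-comm (toℕ a) (toℕ b))

  +ₙ-identityˡ : ∀ (a : ℤₙ) → zero +ₙ a ≡ a
  +ₙ-identityˡ = residue-toℕ

  +ₙ-identityʳ : ∀ (a : ℤₙ) → a +ₙ zero ≡ a
  +ₙ-identityʳ a = ≡-trans (+ₙ-comm a zero) (+ₙ-identityˡ a)

  +ₙ-assoc : ∀ (a b c : ℤₙ) → (a +ₙ b) +ₙ c ≡ a +ₙ (b +ₙ c)
  +ₙ-assoc a b c = begin
    residue (i +ℕ j) +ₙ c         ≡⟨ cong (residue (i +ℕ j) +ₙ_) (residue-toℕ c) ⟨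
    residue (i +ℕ j) +ₙ residue k ≡⟨ residue-+ (i +ℕ j) k ⟩
    residue ((i +ℕ j) +ℕ k)       ≡⟨ cong residue (ℕ.+-assoc i j k) ⟩
    residue (i +ℕ (j +ℕ k))       ≡⟨ residue-+ i (j +ℕ k) ⟨
    residue i +ₙ residue (j +ℕ k) ≡⟨ cong (_+ₙ residue (j +ℕ k)) (residue-toℕ a) ⟩
    a +ₙ residue (j +ℕ k)         ∎
    where
    open ≡-Reasoning
    i = toℕ a
    j = toℕ b
    k = toℕ c

  -- At `zero` the difference is `n` itself, which `residue` reduces to 0.
  -ₙ_ : ℤₙ → ℤₙ
  -ₙ a = residue (n ∸ toℕ a)

  +ₙ-inverseˡ : ∀ a → (-ₙ a) +ₙ a ≡ zero
  +ₙ-inverseˡ a = begin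
    (-ₙ a) +ₙ a                ≡⟨ cong ((-ₙ a) +ₙ_) (residue-toℕ a) ⟨
    (-ₙ a) +ₙ residue (toℕ a)  ≡⟨ residue-+ (n ∸ toℕ a) (toℕ a) ⟩
    residue (n ∸ toℕ a +ℕ toℕ a) ≡⟨ cong residue (ℕ.m∸n+n≡m (ℕ.<⇒≤ (toℕ<n a))) ⟩
    residue n                  ≡⟨ toℕ-injective (≡-trans (toℕ-fromℕ< _) (n%n≡0 n)) ⟩
    zero                       ∎
    where open ≡-Reasoning

  +ₙ-cancelˡ : ∀ (a : ℤₙ) {b c} → a +ₙ b ≡ a +ₙ c → b ≡ c
  +ₙ-cancelˡ a {b} {c} eq = begin
    b                   ≡⟨ undo b ⟨
    (-ₙ a) +ₙ (a +ₙ b)  ≡⟨ cong ((-ₙ a) +ₙ_) eq ⟩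
    (-ₙ a) +ₙ (a +ₙ c)  ≡⟨ undo c ⟩
    c                   ∎
    where
    open ≡-Reasoning
    undo : ∀ d → (-ₙ a) +ₙ (a +ₙ d) ≡ d
    undo d = begin
      (-ₙ a) +ₙ (a +ₙ d)  ≡⟨ +ₙ-assoc (-ₙ a) a d ⟨
      ((-ₙ a) +ₙ a) +ₙ d  ≡⟨ cong (_+ₙ d) (+ₙ-inverseˡ a) ⟩
      zero +ₙ d           ≡⟨ +ₙ-identityˡ d ⟩
      d                   ∎

  -- Sums of lists and zero sums

  -- A left fold, so that the entries of partialSums xs are definitionally the
  -- sums of the prefixes of xs.
  Σ : List ℤₙ → ℤₙ
  Σ = foldl _+ₙ_ zero

  foldl-+ₙ-↭ : ∀ {xs ys} → xs ↭ ys → ∀ (s : ℤₙ) → foldl _+ₙ_ s xs ≡ foldl _+ₙ_ s ys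
  foldl-+ₙ-↭ refl s = refl
  foldl-+ₙ-↭ (prep x σ) s = foldl-+ₙ-↭ σ (s +ₙ x)
  foldl-+ₙ-↭ (swap {ys = ys} x y σ) s = ≡-trans (foldl-+ₙ-↭ σ _) (cong (λ t → foldl _+ₙ_ t ys) (begin
    (s +ₙ x) +ₙ y  ≡⟨ +ₙ-assoc s x y ⟩
    s +ₙ (x +ₙ y)  ≡⟨ cong (s +ₙ_) (+ₙ-comm x y) ⟩
    s +ₙ (y +ₙ x)  ≡⟨ +ₙ-assoc s y x ⟨
    (s +ₙ y) +ₙ x  ∎))
    where open ≡-Reasoning
  foldl-+ₙ-↭ (trans σ τ) s = ≡-trans (foldl-+ₙ-↭ σ s) (foldl-+ₙ-↭ τ s)

  Σ-↭ : ∀ {xs ys} → xs ↭ ys → Σ xs ≡ Σ ys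
  Σ-↭ σ = foldl-+ₙ-↭ σ zero

  Σ-∷ : ∀ x xs → Σ (x ∷ xs) ≡ Σ xs +ₙ x
  Σ-∷ x xs = ≡-trans (Σ-↭ (++-comm (x ∷ []) xs)) (foldl-∷ʳ _+ₙ_ zero x xs)

  ZeroSum : List ℤₙ → Set
  ZeroSum xs = Σ xs ≡ zero

  ZeroSum-tail⇒head≡Σ : ∀ {x xs as} → x ∷ xs ↭ as → ZeroSum xs → x ≡ Σ as
  ZeroSum-tail⇒head≡Σ {x} {xs} {as} σ eq = begin
    x            ≡⟨ +ₙ-identityˡ x ⟨
    zero +ₙ x    ≡⟨ cong (_+ₙ x) eq ⟨
    Σ xs +ₙ x    ≡⟨ Σ-∷ x xs ⟨
    Σ (x ∷ xs)   ≡⟨ Σ-↭ σ ⟩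
    Σ as         ∎
    where open ≡-Reasoning

  head≡Σ⇒ZeroSum-tail : ∀ {x xs as} → x ∷ xs ↭ as → x ≡ Σ as → ZeroSum xs
  head≡Σ⇒ZeroSum-tail {x} {xs} {as} σ eq = +ₙ-cancelˡ x (begin
    x +ₙ Σ xs    ≡⟨ +ₙ-comm x (Σ xs) ⟩
    Σ xs +ₙ x    ≡⟨ Σ-∷ x xs ⟨
    Σ (x ∷ xs)   ≡⟨ Σ-↭ σ ⟩
    Σ as         ≡⟨ eq ⟨
    x            ≡⟨ +ₙ-identityʳ x ⟨
    x +ₙ zero    ∎)
    where open ≡-Reasoning

  -- Cancel the common part `xs`. With one common element this makes the zero-sum pairs a matching;
  -- with two it compares triples.
  ZeroSum-heads : ∀ xs {x y as bs} → as ↭ x ∷ xs → bs ↭ y ∷ xs → ZeroSum as → ZeroSum bs → x ≡ y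
  ZeroSum-heads xs {x} {y} σ τ p q = +ₙ-cancelˡ (Σ xs) (begin
    Σ xs +ₙ x    ≡⟨ Σ-∷ x xs ⟨
    Σ (x ∷ xs)   ≡⟨ Σ-↭ σ ⟨
    _            ≡⟨ ≡-trans p (sym q) ⟩
    _            ≡⟨ Σ-↭ τ ⟩
    Σ (y ∷ xs)   ≡⟨ Σ-∷ y xs ⟩
    Σ xs +ₙ y    ∎)
    where open ≡-Reasoning

  -- Zero blocks and repeated partial sums

  -- A block is a prefix of a suffix: the recursion runs through the suffixes, `partialSums` through
  -- the prefixes of each.
  NoZeroBlock : List ℤₙ → Set
  NoZeroBlock []       = ⊤
  NoZeroBlock (x ∷ xs) = All (_≢ zero) (partialSums (x ∷ xs)) × NoZeroBlock xs

  partialSumsFrom-+ₙ : ∀ (s t : ℤₙ) xs → partialSumsFrom (s +ₙ t) xs ≡ map (s +ₙ_) (partialSumsFrom t xs)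
  partialSumsFrom-+ₙ s t []       = refl
  partialSumsFrom-+ₙ s t (x ∷ xs) = cong₂ _∷_ (+ₙ-assoc s t x)
    (≡-trans (cong (λ u → partialSumsFrom u xs) (+ₙ-assoc s t x)) (partialSumsFrom-+ₙ s (t +ₙ x) xs))

  -- Starting at `s` translates all partial sums by `s`, so a return to `s` would be a prefix of sum
  -- zero.
  fresh-partialSumsFrom : ∀ (s : ℤₙ) xs → All (_≢ zero) (partialSums xs) → All (s ≢_) (partialSumsFrom s xs)
  fresh-partialSumsFrom s xs nz = subst (All (s ≢_))
    (≡-trans (sym (partialSumsFrom-+ₙ s zero xs)) (cong (λ t → partialSumsFrom t xs) (+ₙ-identityʳ s)))
    (map⁺ (All.map (λ t≢0 eq → t≢0 (+ₙ-cancelˡ s (≡-trans (sym eq) (sym (+ₙ-identityʳ s))))) nz))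

  -- The start `s` is not itself listed, so blocks containing `a` are never differences of two
  -- listed sums; only `xs` is constrained.
  unique-partialSumsFrom : ∀ s a xs → NoZeroBlock xs → Unique (partialSumsFrom s (a ∷ xs))
  unique-partialSumsFrom s a []       _          = [] ∷ []
  unique-partialSumsFrom s a (x ∷ xs) (nz , nzb) =
    fresh-partialSumsFrom (s +ₙ a) (x ∷ xs) nz ∷ unique-partialSumsFrom (s +ₙ a) x xs nzb

  Σ[_]≢0 : ∀ {x : ℤₙ} → x ≢ zero → Σ (x ∷ []) ≢ zero
  Σ[_]≢0 {x} = subst (_≢ zero) (sym (+ₙ-identityˡ x))

  -- Arranging at most four elements

  Arrangement : List ℤₙ → Set
  Arrangement xs = ∃[ ys ] (ys ↭ xs × NoZeroBlock ys)

  Arrangement-resp-↭ : ∀ {xs ys} → xs ↭ ys → Arrangement xs → Arrangement ys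
  Arrangement-resp-↭ σ (zs , τ , nzb) = zs , trans τ σ , nzb

  -- Any two of the three pairs share an element, so at most one pair cancels; it is placed at the
  -- two ends.
  separate : ∀ {b c d} → Unique (b ∷ c ∷ d ∷ []) →
             ∃[ x ] ∃[ y ] ∃[ z ] (x ∷ y ∷ z ∷ [] ↭ b ∷ c ∷ d ∷ [] ×
               ¬ ZeroSum (x ∷ y ∷ []) × ¬ ZeroSum (y ∷ z ∷ []))
  separate {b} {c} {d} ((b≢c ∷ b≢d ∷ []) ∷ (c≢d ∷ []) ∷ _)
    with Σ (b ∷ c ∷ []) ≟ zero | Σ (c ∷ d ∷ []) ≟ zero
  ... | no bc≢0 | no cd≢0 = b , c , d , refl , bc≢0 , cd≢0
  ... | yes bc≡0 | _ = b , d , c , prep b (swap d c refl) ,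
        (λ p → c≢d (ZeroSum-heads (b ∷ []) (swap b c refl) (swap b d refl) bc≡0 p)) ,
        (λ p → b≢d (ZeroSum-heads (c ∷ []) refl refl bc≡0 p))
  ... | no _ | yes cd≡0 = c , b , d , swap c b refl ,
        (λ p → b≢d (ZeroSum-heads (c ∷ []) (swap c b refl) (swap c d refl) p cd≡0)) ,
        (λ p → b≢c (ZeroSum-heads (d ∷ []) refl refl p cd≡0))

  arrange₃ : ∀ {b c d} → Unique (b ∷ c ∷ d ∷ []) → All (_≢ zero) (b ∷ c ∷ d ∷ []) →
             ¬ ZeroSum (b ∷ c ∷ d ∷ []) → Arrangement (b ∷ c ∷ d ∷ [])
  arrange₃ u nz Σ≢0 with separate u
  ... | x , y , z , σ , xy , yz with All-resp-↭ (↭-sym σ) nz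
  ... | x≢0 ∷ y≢0 ∷ z≢0 ∷ [] = _ , σ ,
        (Σ[ x≢0 ]≢0 ∷ xy ∷ Σ≢0 ∘ ≡-trans (sym (Σ-↭ σ)) ∷ []) ,
        (Σ[ y≢0 ]≢0 ∷ yz ∷ []) , (Σ[ z≢0 ]≢0 ∷ []) , tt

  noZeroBlock₄ : ∀ {x y z t} → All (_≢ zero) (x ∷ y ∷ z ∷ t ∷ []) →
                 ¬ ZeroSum (x ∷ y ∷ []) → ¬ ZeroSum (y ∷ z ∷ []) → ¬ ZeroSum (z ∷ t ∷ []) →
                 ¬ ZeroSum (x ∷ y ∷ z ∷ []) → ¬ ZeroSum (y ∷ z ∷ t ∷ []) →
                 ¬ ZeroSum (x ∷ y ∷ z ∷ t ∷ []) → NoZeroBlock (x ∷ y ∷ z ∷ t ∷ [])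
  noZeroBlock₄ (x≢0 ∷ y≢0 ∷ z≢0 ∷ t≢0 ∷ []) xy yz zt xyz yzt xyzt =
    (Σ[ x≢0 ]≢0 ∷ xy ∷ xyz ∷ xyzt ∷ []) ,
    (Σ[ y≢0 ]≢0 ∷ yz ∷ yzt ∷ []) , (Σ[ z≢0 ]≢0 ∷ zt ∷ []) , (Σ[ t≢0 ]≢0 ∷ []) , tt

  -- If some element cancels `w`, it is unique and becomes `x`; otherwise any choice of `x` works.
  partnerFirst : ∀ w (v : Vec ℤₙ 3) → Unique (toList v) →
                 ∃[ x ] ∃[ z ] ∃[ u ] (x ∷ z ∷ u ∷ [] ↭ toList v ×
                   ¬ ZeroSum (w ∷ z ∷ []) × ¬ ZeroSum (w ∷ u ∷ []))
  partnerFirst w v uniq with any? (λ y → Σ (w ∷ y ∷ []) ≟ zero) (toList v)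
  partnerFirst w (x ∷ z ∷ u ∷ []) uniq | no ¬partner with ¬Any⇒All¬ _ ¬partner
  ... | _ ∷ wz ∷ wu ∷ [] = x , z , u , refl , wz , wu
  partnerFirst w v uniq | yes partner with find partner
  ... | x , x∈v , wx≡0 with extract v x∈v
  ... | z ∷ u ∷ [] , σ with Unique-resp-↭ (↭-sym σ) uniq
  ... | (x≢z ∷ x≢u ∷ []) ∷ _ = x , z , u , σ ,
        (λ p → x≢z (ZeroSum-heads (w ∷ []) (swap w x refl) (swap w z refl) wx≡0 p)) ,
        (λ p → x≢u (ZeroSum-heads (w ∷ []) (swap w x refl) (swap w u refl) wx≡0 p))

  -- The order is `z`, `w`, `u`, `x`: the only possible partner `x` of `w` stays away from it, and
  -- `w` interrupts the zero triple.
  arrange₄-zeroTriple : ∀ {w x z u} → let A = w ∷ x ∷ z ∷ u ∷ [] in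
    Unique A → All (_≢ zero) A → ¬ ZeroSum A → ZeroSum (x ∷ z ∷ u ∷ []) →
    ¬ ZeroSum (w ∷ z ∷ []) → ¬ ZeroSum (w ∷ u ∷ []) → Arrangement A
  arrange₄-zeroTriple {w} {x} {z} {u} ((w≢x ∷ w≢z ∷ w≢u ∷ []) ∷ _) nz@(_ ∷ _ ∷ z≢0 ∷ _) Σ≢0 xzu≡0 wz wu =
    z ∷ w ∷ u ∷ x ∷ [] , σ ,
    noZeroBlock₄ (All-resp-↭ (↭-sym σ) nz)
      (wz ∘ ≡-trans (Σ-↭ {w ∷ z ∷ []} (swap w z refl)))
      wu
      -- Subtracting this pair from the zero triple would leave `z` equal to zero.
      (λ ux≡0 → z≢0 (≡-trans (ZeroSum-tail⇒head≡Σ zux↭xzu ux≡0) xzu≡0))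
      -- Each triple of the new order arises from the zero triple by exchanging one element for `w`.
      (λ p → w≢x (ZeroSum-heads (z ∷ u ∷ []) (swap z w refl) refl p xzu≡0))
      (λ p → w≢z (ZeroSum-heads (u ∷ x ∷ []) refl (↭-sym zux↭xzu) p xzu≡0))
      (Σ≢0 ∘ ≡-trans (sym (Σ-↭ σ)))
    where
    zux↭xzu : z ∷ u ∷ x ∷ [] ↭ x ∷ z ∷ u ∷ []
    zux↭xzu = ++-comm (z ∷ u ∷ []) (x ∷ [])
    σ : z ∷ w ∷ u ∷ x ∷ [] ↭ w ∷ x ∷ z ∷ u ∷ []
    σ = trans (swap z w refl) (prep w zux↭xzu)

  -- For four elements this excludes zero triples; quantifying over permutations makes it
  -- independent of the order.
  NoZeroTail : List ℤₙ → Set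
  NoZeroTail xs = ∀ {y ys} → y ∷ ys ↭ xs → ¬ ZeroSum ys

  noZeroBlock₄-noZeroTail : ∀ {x y z t} → let A = x ∷ y ∷ z ∷ t ∷ [] in
    All (_≢ zero) A → ¬ ZeroSum A → NoZeroTail A →
    ¬ ZeroSum (x ∷ y ∷ []) → ¬ ZeroSum (y ∷ z ∷ []) → ¬ ZeroSum (z ∷ t ∷ []) → NoZeroBlock A
  noZeroBlock₄-noZeroTail {x} {y} {z} {t} nz Σ≢0 nzt xy yz zt =
    noZeroBlock₄ nz xy yz zt (nzt (++-comm (t ∷ []) (x ∷ y ∷ z ∷ []))) (nzt refl) Σ≢0

  arrange₄-noZeroTriple : ∀ {w x z u} → let A = w ∷ x ∷ z ∷ u ∷ [] in
    Unique A → All (_≢ zero) A → ¬ ZeroSum A → NoZeroTail A →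
    ¬ ZeroSum (w ∷ z ∷ []) → ¬ ZeroSum (w ∷ u ∷ []) → Arrangement A
  arrange₄-noZeroTriple {w} {x} {z} {u} ((w≢x ∷ w≢z ∷ w≢u ∷ []) ∷ uniq) nz Σ≢0 nzt wz wu
    with Σ (w ∷ x ∷ []) ≟ zero
  -- Here `w` and `x` are each other's only partners. Placed at positions one and three, one of them
  -- meets every adjacent pair, and they are not adjacent.
  ... | yes wx≡0 = w ∷ z ∷ x ∷ u ∷ [] , σ ,
        noZeroBlock₄-noZeroTail (All-resp-↭ (↭-sym σ) nz) (Σ≢0 ∘ ≡-trans (sym (Σ-↭ σ))) (λ τ → nzt (trans τ σ))
          wz
          (λ p → w≢z (ZeroSum-heads (x ∷ []) refl refl wx≡0 p))
          (λ p → w≢u (ZeroSum-heads (x ∷ []) refl (swap x u refl) wx≡0 p))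
    where
    σ : w ∷ z ∷ x ∷ u ∷ [] ↭ w ∷ x ∷ z ∷ u ∷ []
    σ = prep w (swap z x refl)
  -- Now `w` cancels none of the others, so it can precede whichever order `separate` returns.
  ... | no wx with separate uniq
  ... | b , c , d , τ , bc , cd
      with All-resp-↭ {P = λ y → ¬ ZeroSum (w ∷ y ∷ [])} (↭-sym τ) (wx ∷ wz ∷ wu ∷ [])
  ... | wb ∷ _ = w ∷ b ∷ c ∷ d ∷ [] , σ ,
        noZeroBlock₄-noZeroTail (All-resp-↭ (↭-sym σ) nz) (Σ≢0 ∘ ≡-trans (sym (Σ-↭ σ))) (λ ρ → nzt (trans ρ σ))
          wb bc cd
    where
    σ : w ∷ b ∷ c ∷ d ∷ [] ↭ w ∷ x ∷ z ∷ u ∷ []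
    σ = prep w τ

  arrange₄ : (v : Vec ℤₙ 4) → let A = toList v in
             Unique A → All (_≢ zero) A → ¬ ZeroSum A → Arrangement A
  arrange₄ v uniq nz Σ≢0 with any? (Σ (toList v) ≟_) (toList v)
  arrange₄ v uniq nz Σ≢0 | yes ΣA∈A with extract v ΣA∈A
  ... | v′ , σ with Unique-resp-↭ (↭-sym σ) uniq
  ... | _ ∷ uniq′ with partnerFirst (Σ (toList v)) v′ uniq′
  ... | x , z , u , τ , wz , wu = Arrangement-resp-↭ ρ
        (arrange₄-zeroTriple (Unique-resp-↭ (↭-sym ρ) uniq) (All-resp-↭ (↭-sym ρ) nz)
          (Σ≢0 ∘ ≡-trans (sym (Σ-↭ ρ))) xzu≡0 wz wu)
    where
    ρ : Σ (toList v) ∷ x ∷ z ∷ u ∷ [] ↭ toList v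
    ρ = trans (prep _ τ) σ
    xzu≡0 : ZeroSum (x ∷ z ∷ u ∷ [])
    xzu≡0 = head≡Σ⇒ZeroSum-tail ρ refl
  arrange₄ (w ∷ v) uniq nz Σ≢0 | no ΣA∉A with uniq
  ... | _ ∷ uniq′ with partnerFirst w v uniq′
  ... | x , z , u , τ , wz , wu = Arrangement-resp-↭ ρ
        (arrange₄-noZeroTriple (Unique-resp-↭ (↭-sym ρ) uniq) (All-resp-↭ (↭-sym ρ) nz)
          (Σ≢0 ∘ ≡-trans (sym (Σ-↭ ρ))) nzt wz wu)
    where
    ρ : w ∷ x ∷ z ∷ u ∷ [] ↭ w ∷ toList v
    ρ = prep w τ
    nzt : NoZeroTail (w ∷ x ∷ z ∷ u ∷ [])
    -- The element omitted from a zero triple would be the total, which is not in the list.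
    nzt π ys≡0 = ΣA∉A (∈-resp-↭ (trans π ρ) (here (sym (ZeroSum-tail⇒head≡Σ (trans π ρ) ys≡0))))

  arrange≤4 : ∀ xs → Unique xs → All (_≢ zero) xs → length xs ≤ 4 → ¬ ZeroSum xs → Arrangement xs
  arrange≤4 [] _ _ _ _ = [] , refl , tt
  arrange≤4 (a ∷ []) _ _ _ Σ≢0 = a ∷ [] , refl , (Σ≢0 ∷ []) , tt
  arrange≤4 (a ∷ b ∷ []) _ (a≢0 ∷ b≢0 ∷ []) _ Σ≢0 =
    a ∷ b ∷ [] , refl , (Σ[ a≢0 ]≢0 ∷ Σ≢0 ∷ []) , (Σ[ b≢0 ]≢0 ∷ []) , tt
  arrange≤4 (a ∷ b ∷ c ∷ []) uniq nz _ Σ≢0 = arrange₃ uniq nz Σ≢0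
  arrange≤4 (a ∷ b ∷ c ∷ d ∷ []) uniq nz _ Σ≢0 = arrange₄ (a ∷ b ∷ c ∷ d ∷ []) uniq nz Σ≢0
  arrange≤4 (_ ∷ _ ∷ _ ∷ _ ∷ _ ∷ _) _ _ (s≤s (s≤s (s≤s (s≤s ())))) _

  -- Choosing the first entry

  order-from : ∀ {A} x xs → x ∷ xs ↭ A → Unique A → All (_≢ zero) A → length xs ≤ 4 → ¬ ZeroSum xs →
               ∃ λ ordering → (ordering ↭ A) × Unique (partialSums ordering)
  order-from x xs σ uniq nz len Σ≢0 with Unique-resp-↭ (↭-sym σ) uniq | All-resp-↭ (↭-sym σ) nz
  ... | _ ∷ uniq′ | _ ∷ nz′ with arrange≤4 xs uniq′ nz′ len Σ≢0
  ... | ys , τ , nzb = x ∷ ys , trans (prep x τ) σ , unique-partialSumsFrom zero x ys nzb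

theorem1 : (m : ℕ) (A : List (Fin (suc m))) →
    Unique A → All (λ a → a ≢ zero) A → length A ≤ 5 →
    ∃ λ (ordering : List (Fin (suc m))) →
    (ordering ↭ A) × Unique (partialSums ordering)
theorem1 m [] _ _ _ = [] , refl , []
-- A single element equals the total, so no first entry different from it exists; one partial sum is
-- trivially distinct.
theorem1 m (a ∷ []) _ _ _ = a ∷ [] , refl , [] ∷ []
theorem1 m A@(a ∷ b ∷ xs) uniq@((a≢b ∷ _) ∷ _) nz (s≤s len) with a ≟ Σ A
... | no a≢ΣA = order-from a (b ∷ xs) refl uniq nz len (a≢ΣA ∘ ZeroSum-tail⇒head≡Σ {xs = b ∷ xs} refl)
-- Since `a` is the total, the distinct element `b` is not, and can go first.
... | yes a≡ΣA = order-from b (a ∷ xs) (swap b a refl) uniq nz len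
      (λ axs≡0 → a≢b (≡-trans a≡ΣA (sym (ZeroSum-tail⇒head≡Σ {xs = a ∷ xs} (swap b a refl) axs≡0))))
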